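{- There exists a finite poset $P$ such that there is no finite poset $P'$ in which every chain has at most two elements with $\mathcal{K}P'$ combinatorially equivalent to $\mathcal{K}P$.
   Context: For a finite poset $(P,\preceq)$: a lower set is $L\subseteq P$ with $y\preceq x\in L\Rightarrow y\in L$; $\partial x=\{y: y\prec x\}$; the bundle of $x$ is $\mathrm{bu}(x)=\{y:\partial y=\partial x\}$; a subset is connected if it induces a connected subgraph of the Hasse diagram; a lower set $L$ is filled if for every $x\in P$ with $\partial x\subseteq L$ we have $L\cap\mathrm{bu}(x)\ne\emptyset$; a tube is a filled connected lower set; a tubing is a set of tubes, none equal to $P$, pairwise disjoint or nested, such that the union of the tubes of every nonempty subset is filled. The poset associahedron $\mathcal{K}P$ is a convex polytope whose poset of nonempty faces (ordered by inclusion) is isomorphic to the set of tubings of $P$ ordered by reverse containment, unique up to combinatorial equivalence (isomorphism of face posets). -}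

module Defs where

open import Data.Nat using (ℕ)
open import Data.Bool using (Bool; true; false)
open import Data.Fin using (Fin)
open import Data.Fin.Subset using (Subset; _∈_; _⊆_; ⊤)
open import Data.Product using (Σ; ∃; _×_; _,_)
open import Data.Sum using (_⊎_)
open import Relation.Nullary using (¬_)
open import Relation.Binary.PropositionalEquality using (_≡_; _≢_)

record FinPoset : Set where
  field
    n       : ℕ
    _≼_     : Fin n → Fin n → Bool
    refl≼   : ∀ x → (x ≼ x) ≡ true
    antisym : ∀ x y → (x ≼ y) ≡ true → (y ≼ x) ≡ true → x ≡ y
    trans≼  : ∀ x y z → (x ≼ y) ≡ true → (y ≼ z) ≡ true → (x ≼ z) ≡ true

module _ (P : FinPoset) where
  open FinPoset P

  El : Set
  El = Fin n

  _≺_ : El → El → Set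
  y ≺ x = (y ≼ x) ≡ true × y ≢ x

  Covers : El → El → Set
  Covers y x = y ≺ x × (∀ z → ¬ (y ≺ z × z ≺ x))

  HasseAdj : El → El → Set
  HasseAdj x y = Covers x y ⊎ Covers y x

  IsLowerP : (El → Set) → Set
  IsLowerP M = ∀ x y → (y ≼ x) ≡ true → M x → M y

  BoundaryIn : El → (El → Set) → Set
  BoundaryIn x M = ∀ y → y ≺ x → M y

  InBundle : El → El → Set
  InBundle x y = ∀ z → (z ≺ y → z ≺ x) × (z ≺ x → z ≺ y)

  FilledP : (El → Set) → Set
  FilledP M = IsLowerP M × (∀ x → BoundaryIn x M → ∃ λ y → M y × InBundle x y)

  Filled : Subset n → Set
  Filled S = FilledP (_∈ S)

  data PathIn (S : Subset n) : El → El → Set where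
    here : ∀ {x} → x ∈ S → PathIn S x x
    step : ∀ {x y z} → x ∈ S → HasseAdj x y → PathIn S y z → PathIn S x z

  Connected : Subset n → Set
  Connected S = ∀ x y → x ∈ S → y ∈ S → PathIn S x y

  IsTube : Subset n → Set
  IsTube S = Filled S × Connected S

  Family : Set
  Family = Subset n → Bool

  _∈F_ : Subset n → Family → Set
  S ∈F T = T S ≡ true

  _⊆F_ : Family → Family → Set
  U ⊆F T = ∀ S → S ∈F U → S ∈F T

  Disjoint : Subset n → Subset n → Set
  Disjoint S R = ∀ x → ¬ (x ∈ S × x ∈ R)

  UnionMem : Family → El → Set
  UnionMem U x = ∃ λ S → S ∈F U × x ∈ S

  IsTubing : Family → Set
  IsTubing T =
      (∀ S → S ∈F T → IsTube S × S ≢ ⊤)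
    × (∀ S R → S ∈F T → R ∈F T → Disjoint S R ⊎ (S ⊆ R ⊎ R ⊆ S))
    × (∀ (U : Family) → U ⊆F T → (∃ λ S → S ∈F U) → FilledP (UnionMem U))

  Tubing : Set
  Tubing = Σ Family IsTubing

  _≤T_ : Tubing → Tubing → Set
  (T , _) ≤T (T' , _) = T' ⊆F T

Height≤2 : FinPoset → Set
Height≤2 P = ∀ x y z → ¬ (_≺_ P x y × _≺_ P y z)

-- isomorphism of the posets of tubings (ordered by reverse containment);
-- equality of tubings is extensional, i.e. ≤ both ways.
TubingIso : FinPoset → FinPoset → Set
TubingIso P Q =
  Σ (Tubing P → Tubing Q) λ f → Σ (Tubing Q → Tubing P) λ g →
      (∀ a b → _≤T_ P a b → _≤T_ Q (f a) (f b))
    × (∀ a b → _≤T_ Q a b → _≤T_ P (g a) (g b))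
    × (∀ a → _≤T_ P (g (f a)) a × _≤T_ P a (g (f a)))
    × (∀ b → _≤T_ Q (f (g b)) b × _≤T_ Q b (f (g b)))

-- 𝒦P and 𝒦Q are combinatorially equivalent iff their face posets are
-- isomorphic, i.e. iff their tubing posets are isomorphic.
CombEquivK : FinPoset → FinPoset → Set
CombEquivK = TubingIso

{-# OPTIONS --safe #-}
module Submission where

-- The poset P below has height 3 and its polytope is an octagonal prism: the tubes of P are a, b
-- and an 8-cycle c, where a and b are compatible with everything except each other.
-- Let P' of height at most 2 have the same compatibility graph. Each tube of P' is either small
-- (a minimal element together with at most one element whose boundary is that minimal element) or
-- contains two small ones. Two incompatible small tubes span a set J containing no other tubes, so
-- everything compatible with J is compatible with both; hence no two small tubes on the cycle are
-- at distance 3 or more ("far": their only common neighbours are a and b). This yields an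
-- edge X ⊂ Y of the cycle, far from some tube S on it, such that the small tubes inside
-- X and Y are exactly a and b, and S is small or of the same kind.
-- An element e of Y outside X has its boundary split between a and b. If e ∈ S, then a ∪ b ∪ {e}
-- is a tube inside S and Y; if e ∉ S, then S ∪ X can be saturated to a proper tube without e.
-- Both contradict that far tubes have no common neighbours besides a and b.

open import Defs
open import Data.Bool using (Bool; true; false; _∨_)
import Data.Bool.Properties as Bool
open import Data.Empty using (⊥; ⊥-elim)
open import Data.Fin using (Fin; zero; suc; _≟_; toℕ)
open import Data.Fin.Properties using (all?; any?)
open import Data.Fin.Subset using (Subset; _∈_; _∉_; _⊆_; _∪_; ⊤)
open import Data.Fin.Subset.Properties
  using (_∈?_; _⊆?_; anySubset?; ⊆-antisym; ⊆-trans; ⊆-refl; ∈⊤; p⊆p∪q; q⊆p∪q; x∈p∪q⁻; x∈p∪q⁺; ∪-comm)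
open import Data.Nat using (ℕ; zero; suc)
open import Data.Nat.DivMod using (_mod_)
open import Data.Product using (Σ; ∃; ∃₂; _×_; _,_; proj₁; proj₂)
open import Data.Sum using (_⊎_; inj₁; inj₂; [_,_]′; swap)
open import Data.Vec using ([]; _∷_; tabulate; lookup)
import Data.Vec.Properties as Vec
open import Function using (_∘_; id; case_of_)
open import Relation.Binary.PropositionalEquality
  using (_≡_; _≢_; refl; sym; trans; cong; subst)
open import Relation.Nullary using (¬_; Dec; yes; no; does; contradiction)
open import Relation.Nullary.Decidable
  using (map′; ¬?; _×-dec_; _⊎-dec_; _→-dec_; from-yes; decidable-stable; dec-true)
open import Relation.Unary using (Decidable)

-- Finite subsets and membership.

_≟ₛ_ : ∀ {n} (S R : Subset n) → Dec (S ≡ R)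
_≟ₛ_ = Vec.≡-dec Bool._≟_

module _ {n : ℕ} {M : Fin n → Set} (M? : Decidable M) where

  ⟦_⟧ : Subset n
  ⟦_⟧ = tabulate (does ∘ M?)

  ∈⟦⟧⁺ : ∀ {x} → M x → x ∈ ⟦_⟧
  ∈⟦⟧⁺ {x} m = Vec.lookup⇒[]= x ⟦_⟧ (trans (Vec.lookup∘tabulate _ x) (dec-true (M? x) m))

  ∈⟦⟧⁻ : ∀ {x} → x ∈ ⟦_⟧ → M x
  ∈⟦⟧⁻ {x} x∈ with M? x | trans (sym (Vec.lookup∘tabulate (does ∘ M?) x)) (Vec.[]=⇒lookup x∈)
  ... | yes m | _  = m
  ... | no _  | ()

⊈⇒∃∉ : ∀ {n} {S R : Subset n} → ¬ (S ⊆ R) → ∃ λ x → x ∈ S × x ∉ R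
⊈⇒∃∉ {n} {S} {R} S⊈R with any? (λ x → (x ∈? S) ×-dec ¬? (x ∈? R))
... | yes found = found
... | no none   = contradiction
  (λ {x} x∈S → decidable-stable (x ∈? R) (λ x∉R → none (x , x∈S , x∉R))) S⊈R

≢⊤⇒∃∉ : ∀ {n} {S : Subset n} → S ≢ ⊤ → ∃ (_∉ S)
≢⊤⇒∃∉ S≢⊤ with ⊈⇒∃∉ (λ ⊤⊆S → S≢⊤ (⊆-antisym (λ _ → ∈⊤) ⊤⊆S))
... | x , _ , x∉S = x , x∉S

⊆-≢⊤ : ∀ {n} {S R : Subset n} → S ⊆ R → R ≢ ⊤ → S ≢ ⊤
⊆-≢⊤ S⊆R R≢⊤ refl = R≢⊤ (⊆-antisym (λ _ → ∈⊤) S⊆R)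

-- Tubings with at most two tubes.

module _ (Q : FinPoset) where
  open FinPoset Q

  ProperTube : Subset n → Set
  ProperTube S = IsTube Q S × S ≢ ⊤

  -- For proper tubes this means occurring in a common tubing, by `coupleTubing` and
  -- `Tubing-Compatible`; so the face order determines it.
  Compatible : Subset n → Subset n → Set
  Compatible S R = (Disjoint Q S R ⊎ (S ⊆ R ⊎ R ⊆ S)) × Filled Q (S ∪ R)

  FilledP-resp : ∀ {M N : El Q → Set} → (∀ {x} → M x → N x) → (∀ {x} → N x → M x) →
                 FilledP Q M → FilledP Q N
  FilledP-resp M⇒N N⇒M (lower , fill) =
    (λ x y y≼x → M⇒N ∘ lower x y y≼x ∘ N⇒M) ,
    λ x ∂x⊆N → case fill x (λ y → N⇒M ∘ ∂x⊆N y) of λ (y , My , xy) → y , M⇒N My , xy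

  Filled-lower : ∀ {S} → Filled Q S → ∀ {x y} → _≺_ Q y x → x ∈ S → y ∈ S
  Filled-lower (lower , _) {x} {y} y≺x = lower x y (proj₁ y≺x)

  ∪-absorb : ∀ {S R : Subset n} → S ⊆ R → R ≡ S ∪ R
  ∪-absorb {S} {R} S⊆R = ⊆-antisym (q⊆p∪q S R) (λ x∈ → [ S⊆R , id ]′ (x∈p∪q⁻ S R x∈))

  ⊆-Compatible : ∀ {S R} → S ⊆ R → Filled Q R → Compatible S R
  ⊆-Compatible {S} {R} S⊆R fR =
    inj₂ (inj₁ S⊆R) , subst (Filled Q) (∪-absorb S⊆R) fR

  Compatible-sym : ∀ {S R} → Compatible S R → Compatible R S
  Compatible-sym {S} {R} (r , f) =
    [ (λ d → inj₁ (λ x (p , q) → d x (q , p))) , inj₂ ∘ swap ]′ r ,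
    FilledP-resp (x∈p∪q⁺ ∘ swap ∘ x∈p∪q⁻ S R) (x∈p∪q⁺ ∘ swap ∘ x∈p∪q⁻ R S) f

  -- `S` and `R` may coincide, which covers the tubings with a single tube as well.
  couple : Subset n → Subset n → Family Q
  couple S R X = does ((X ≟ₛ S) ⊎-dec (X ≟ₛ R))

  ∈-couple⁻ : ∀ {S R} X → _∈F_ Q X (couple S R) → X ≡ S ⊎ X ≡ R
  ∈-couple⁻ {S} {R} X X∈ with X ≟ₛ S | X ≟ₛ R | X∈
  ... | yes p | _     | _  = inj₁ p
  ... | no _  | yes p | _  = inj₂ p
  ... | no _  | no _  | ()

  ∈-couple⁺ : ∀ {S R} X → X ≡ S ⊎ X ≡ R → _∈F_ Q X (couple S R)
  ∈-couple⁺ {S} {R} X p = dec-true ((X ≟ₛ S) ⊎-dec (X ≟ₛ R)) p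

  coupleTubing : ∀ {S R} → ProperTube S → ProperTube R → Compatible S R → Tubing Q
  coupleTubing {S} {R} tS tR (rel , filled) = couple S R , tubes , related , unions
    where
    tubes : ∀ X → _∈F_ Q X (couple S R) → ProperTube X
    tubes X X∈ with ∈-couple⁻ X X∈
    ... | inj₁ refl = tS
    ... | inj₂ refl = tR

    related : ∀ X Y → _∈F_ Q X (couple S R) → _∈F_ Q Y (couple S R) →
              Disjoint Q X Y ⊎ (X ⊆ Y ⊎ Y ⊆ X)
    related X Y X∈ Y∈ with ∈-couple⁻ X X∈ | ∈-couple⁻ Y Y∈
    ... | inj₁ refl | inj₁ refl = inj₂ (inj₁ ⊆-refl)
    ... | inj₁ refl | inj₂ refl = rel
    ... | inj₂ refl | inj₁ refl = proj₁ (Compatible-sym (rel , filled))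
    ... | inj₂ refl | inj₂ refl = inj₂ (inj₁ ⊆-refl)

    unions : ∀ (U : Family Q) → _⊆F_ Q U (couple S R) → (∃ λ X → _∈F_ Q X U) →
             FilledP Q (UnionMem Q U)
    unions U U⊆ (X , X∈U) with U S in uS | U R in uR
    ... | true | true = FilledP-resp
      (λ x∈ → [ (λ p → S , uS , p) , (λ p → R , uR , p) ]′ (x∈p∪q⁻ S R x∈))
      (λ (Y , Y∈U , x∈Y) → case ∈-couple⁻ Y (U⊆ Y Y∈U) of λ where
        (inj₁ refl) → x∈p∪q⁺ (inj₁ x∈Y)
        (inj₂ refl) → x∈p∪q⁺ (inj₂ x∈Y))
      filled
    ... | true | false = FilledP-resp (λ x∈ → S , uS , x∈)
      (λ (Y , Y∈U , x∈Y) → case ∈-couple⁻ Y (U⊆ Y Y∈U) of λ where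
        (inj₁ refl) → x∈Y
        (inj₂ refl) → contradiction (trans (sym Y∈U) uR) λ ())
      (proj₁ (proj₁ tS))
    ... | false | true = FilledP-resp (λ x∈ → R , uR , x∈)
      (λ (Y , Y∈U , x∈Y) → case ∈-couple⁻ Y (U⊆ Y Y∈U) of λ where
        (inj₁ refl) → contradiction (trans (sym Y∈U) uS) λ ()
        (inj₂ refl) → x∈Y)
      (proj₁ (proj₁ tR))
    ... | false | false = ⊥-elim (case ∈-couple⁻ X (U⊆ X X∈U) of λ where
        (inj₁ refl) → contradiction (trans (sym X∈U) uS) λ ()
        (inj₂ refl) → contradiction (trans (sym X∈U) uR) λ ())

  -- The union condition of the tubing is applied to the subfamily `couple S R`.
  Tubing-Compatible : ∀ (T : Tubing Q) {S R} → _∈F_ Q S (proj₁ T) → _∈F_ Q R (proj₁ T) → Compatible S R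
  Tubing-Compatible (T , _ , related , unions) {S} {R} S∈ R∈ =
    related S R S∈ R∈ ,
    FilledP-resp
      (λ (Y , Y∈ , x∈Y) → case ∈-couple⁻ Y Y∈ of λ where
        (inj₁ refl) → x∈p∪q⁺ (inj₁ x∈Y)
        (inj₂ refl) → x∈p∪q⁺ (inj₂ x∈Y))
      (λ x∈ → [ (λ p → S , ∈-couple⁺ S (inj₁ refl) , p)
              , (λ p → R , ∈-couple⁺ R (inj₂ refl) , p) ]′ (x∈p∪q⁻ S R x∈))
      (unions (couple S R)
        (λ Y Y∈ → case ∈-couple⁻ Y Y∈ of λ where
          (inj₁ refl) → S∈
          (inj₂ refl) → R∈)
        (S , ∈-couple⁺ S (inj₁ refl)))

  singleton : ∀ {S} → ProperTube S → Tubing Q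
  singleton tS = coupleTubing tS tS (⊆-Compatible ⊆-refl (proj₁ (proj₁ tS)))

  ∈-singleton⁺ : ∀ {S} (tS : ProperTube S) → _∈F_ Q S (proj₁ (singleton tS))
  ∈-singleton⁺ {S} tS = ∈-couple⁺ S (inj₁ refl)

  ∈-singleton⁻ : ∀ {S} (tS : ProperTube S) X → _∈F_ Q X (proj₁ (singleton tS)) → X ≡ S
  ∈-singleton⁻ tS X = [ id , id ]′ ∘ ∈-couple⁻ X

  -- The order on tubings is reversed: containing S means lying below {S}.
  ∈⇒≤singleton : ∀ {S} (tS : ProperTube S) (T : Tubing Q) → _∈F_ Q S (proj₁ T) →
                 _≤T_ Q T (singleton tS)
  ∈⇒≤singleton tS T S∈T X X∈ with ∈-singleton⁻ tS X X∈
  ... | refl = S∈T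

  ∅ : Tubing Q
  ∅ = (λ _ → false) , (λ _ ()) , (λ _ _ ()) ,
      λ U U⊆ (S , S∈U) → contradiction (U⊆ S S∈U) λ ()

-- Action of an isomorphism of tubing posets on tubes.

TubingIso-sym : ∀ P Q → TubingIso P Q → TubingIso Q P
TubingIso-sym P Q (f , g , f-mono , g-mono , gf , fg) = g , f , g-mono , f-mono , fg , gf

module _ (P Q : FinPoset) (iso : TubingIso P Q) where

  to : Tubing P → Tubing Q
  to = proj₁ iso

  from : Tubing Q → Tubing P
  from = proj₁ (proj₂ iso)

  -- Tubings are equal only extensionally, so the matching of tubes is recorded through membership
  -- in every tubing and its image. Having both directions makes it symmetric under inverting `iso`.
  Corresponds : Subset (FinPoset.n P) → Subset (FinPoset.n Q) → Set
  Corresponds S R =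
    (∀ a → _∈F_ P S (proj₁ a) → _∈F_ Q R (proj₁ (to a))) ×
    (∀ b → _∈F_ Q R (proj₁ b) → _∈F_ P S (proj₁ (from b)))

  -- `from` sends `singleton Q tR` to a tubing containing `S`, and `to` sends that to one containing
  -- `R'`; the round trip returns the tubing with sole tube `R`.
  Corresponds-unique : ∀ {S R R'} → ProperTube Q R → Corresponds S R → Corresponds S R' → R' ≡ R
  Corresponds-unique tR (_ , R⇒S) (S⇒R' , _) = ∈-singleton⁻ Q tR _
    (proj₂ (proj₂ (proj₂ (proj₂ (proj₂ (proj₂ iso)))) (singleton Q tR)) _
      (S⇒R' _ (R⇒S (singleton Q tR) (∈-singleton⁺ Q tR))))

  Corresponds-Compatible : ∀ {S S' R R'} → ProperTube P S → ProperTube P S' →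
    Corresponds S R → Corresponds S' R' → Compatible P S S' → Compatible Q R R'
  Corresponds-Compatible {S} {S'} tS tS' (S⇒R , _) (S'⇒R' , _) comp =
    Tubing-Compatible Q (to T) (S⇒R T (∈-couple⁺ P {S} {S'} S (inj₁ refl)))
      (S'⇒R' T (∈-couple⁺ P {S} {S'} S' (inj₂ refl)))
    where T = coupleTubing P tS tS' comp

  -- The empty tubing is the top of the reversed order. If `to a` were empty it would lie above the
  -- image of the empty tubing, and applying `from` would put `S` into the empty tubing.
  to-nonempty : ∀ a S → _∈F_ P S (proj₁ a) → ∃ λ R → _∈F_ Q R (proj₁ (to a))
  to-nonempty a S S∈a with anySubset? (λ R → proj₁ (to a) R Bool.≟ true)
  ... | yes found = found
  ... | no none   = contradiction S∈∅ λ ()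
    where
    f-mono = proj₁ (proj₂ (proj₂ iso))
    g-mono = proj₁ (proj₂ (proj₂ (proj₂ iso)))
    gf     = proj₁ (proj₂ (proj₂ (proj₂ (proj₂ iso))))

    f∅⊇fa : _⊆F_ Q (proj₁ (to a)) (proj₁ (to (∅ P)))
    f∅⊇fa R R∈ = contradiction (R , R∈) none

    S∈∅ : _∈F_ P S (λ _ → false)
    S∈∅ = proj₂ (gf (∅ P)) S (g-mono (to (∅ P)) (to a) f∅⊇fa S (proj₁ (gf a) S S∈a))

-- Any tube `R` in the image of the tubing with sole tube `S` works. The tubing of `R` lies above
-- that image, so `g` sends it to a subfamily of the tubing of `S`; this is nonempty by
-- `to-nonempty`, hence contains `S`. Monotonicity then carries membership both ways.
match : ∀ P Q (iso : TubingIso P Q) {S} → ProperTube P S →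
        ∃ λ R → ProperTube Q R × Corresponds P Q iso S R
match P Q iso@(f , g , f-mono , g-mono , gf , fg) {S} tS
  with to-nonempty P Q iso (singleton P tS) S (∈-singleton⁺ P tS)
... | R , R∈f = R , tR , S⇒R , R⇒S
  where
  tR : ProperTube Q R
  tR = proj₁ (proj₂ (f (singleton P tS))) R R∈f

  g[R]⊆[S] : _⊆F_ P (proj₁ (g (singleton Q tR))) (proj₁ (singleton P tS))
  g[R]⊆[S] X X∈ = proj₂ (gf (singleton P tS)) X
    (g-mono _ _ (∈⇒≤singleton Q tR (f (singleton P tS)) R∈f) X X∈)

  S∈g[R] : _∈F_ P S (proj₁ (g (singleton Q tR)))
  S∈g[R] with to-nonempty Q P (TubingIso-sym P Q iso) (singleton Q tR) R (∈-singleton⁺ Q tR)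
  ... | X , X∈ with ∈-singleton⁻ P tS X (g[R]⊆[S] X X∈)
  ... | refl = X∈

  S⇒R : ∀ a → _∈F_ P S (proj₁ a) → _∈F_ Q R (proj₁ (f a))
  S⇒R a S∈a = f-mono _ _ (∈⇒≤singleton P tS a S∈a) R R∈f

  R⇒S : ∀ b → _∈F_ Q R (proj₁ b) → _∈F_ P S (proj₁ (g b))
  R⇒S b R∈b = g-mono _ _ (∈⇒≤singleton Q tR b R∈b) S S∈g[R]

Corresponds-swap : ∀ P Q (iso : TubingIso P Q) {S R} → Corresponds P Q iso S R →
                   Corresponds Q P (TubingIso-sym P Q iso) R S
Corresponds-swap P Q iso (S⇒R , R⇒S) = R⇒S , S⇒R

-- Decidability and paths in the Hasse diagram.

module _ (Q : FinPoset) where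
  open FinPoset Q

  ≺? : ∀ y x → Dec (_≺_ Q y x)
  ≺? y x = ((y ≼ x) Bool.≟ true) ×-dec ¬? (y ≟ x)

  HasseAdj? : ∀ x y → Dec (HasseAdj Q x y)
  HasseAdj? x y = covers? x y ⊎-dec covers? y x
    where
    covers? : ∀ y x → Dec (Covers Q y x)
    covers? y x = ≺? y x ×-dec all? λ z → ¬? (≺? y z ×-dec ≺? z x)

  InBundle? : ∀ x y → Dec (InBundle Q x y)
  InBundle? x y = all? λ z → (≺? z y →-dec ≺? z x) ×-dec (≺? z x →-dec ≺? z y)

  module _ {M : El Q → Set} (M? : Decidable M) where

    BoundaryIn? : ∀ x → Dec (BoundaryIn Q x M)
    BoundaryIn? x = all? λ y → ≺? y x →-dec M? y

    lower? : Dec (IsLowerP Q M)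
    lower? = all? λ x → all? λ y → ((y ≼ x) Bool.≟ true) →-dec (M? x →-dec M? y)

    meetsBundle? : ∀ x → Dec (∃ λ y → M y × InBundle Q x y)
    meetsBundle? x = any? λ y → M? y ×-dec InBundle? x y

  Filled? : ∀ S → Dec (Filled Q S)
  Filled? S = lower? (_∈? S) ×-dec
    all? λ x → BoundaryIn? (_∈? S) x →-dec meetsBundle? (_∈? S) x

  Compatible? : ∀ S R → Dec (Compatible Q S R)
  Compatible? S R =
    ((all? λ x → ¬? ((x ∈? S) ×-dec (x ∈? R))) ⊎-dec ((S ⊆? R) ⊎-dec (R ⊆? S)))
    ×-dec Filled? (S ∪ R)

  path-trans : ∀ {S x y z} → PathIn Q S x y → PathIn Q S y z → PathIn Q S x z
  path-trans (here _)       q = q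
  path-trans (step x∈ xy p) q = step x∈ xy (path-trans p q)

  path-source : ∀ {S x y} → PathIn Q S x y → x ∈ S
  path-source (here x∈)     = x∈
  path-source (step x∈ _ _) = x∈

  path-sym : ∀ {S x y} → PathIn Q S x y → PathIn Q S y x
  path-sym (here x∈)       = here x∈
  path-sym (step x∈ xy p) =
    path-trans (path-sym p) (step (path-source p) (swap xy) (here x∈))

  path-mono : ∀ {S R x y} → S ⊆ R → PathIn Q S x y → PathIn Q R x y
  path-mono S⊆R (here x∈)      = here (S⊆R x∈)
  path-mono S⊆R (step x∈ xy p) = step (S⊆R x∈) xy (path-mono S⊆R p)

  rooted⇒Connected : ∀ {S} r → (∀ {x} → x ∈ S → PathIn Q S x r) → Connected Q S
  rooted⇒Connected r path x y x∈ y∈ = path-trans (path x∈) (path-sym (path y∈))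

-- Labels and the compatibility graph.

data Label : Set where
  a b : Label
  c   : Fin 8 → Label

c-injective : ∀ {i j} → c i ≡ c j → i ≡ j
c-injective refl = refl

next : Fin 8 → Fin 8
next i = suc (toℕ i) mod 8

-- Reflexive, to agree with `Compatible`, which relates every filled set to itself.
adjacent : Label → Label → Bool
adjacent a     b     = false
adjacent b     a     = false
adjacent (c i) (c j) = does (i ≟ j) ∨ (does (j ≟ next i) ∨ does (i ≟ next j))
adjacent _     _     = true

_≟ₗ_ : ∀ (k l : Label) → Dec (k ≡ l)
a   ≟ₗ a   = yes refl
a   ≟ₗ b   = no λ ()
a   ≟ₗ c _ = no λ ()
b   ≟ₗ a   = no λ ()
b   ≟ₗ b   = yes refl
b   ≟ₗ c _ = no λ ()
c _ ≟ₗ a   = no λ ()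
c _ ≟ₗ b   = no λ ()
c i ≟ₗ c j = map′ (cong c) c-injective (i ≟ j)

allLabels? : ∀ {A : Label → Set} → Decidable A → Dec (∀ l → A l)
allLabels? A? = map′
  (λ (pa , pb , pc) → λ { a → pa ; b → pb ; (c i) → pc i })
  (λ p → p a , p b , p ∘ c)
  (A? a ×-dec (A? b ×-dec all? (A? ∘ c)))

anyLabel? : ∀ {A : Label → Set} → Decidable A → Dec (∃ A)
anyLabel? A? = map′
  (λ { (inj₁ p) → a , p ; (inj₂ (inj₁ p)) → b , p ; (inj₂ (inj₂ (i , p))) → c i , p })
  (λ { (a , p) → inj₁ p ; (b , p) → inj₂ (inj₁ p) ; (c i , p) → inj₂ (inj₂ (i , p)) })
  (A? a ⊎-dec (A? b ⊎-dec any? (A? ∘ c)))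

allSubsets? : ∀ {n} {A : Subset n → Set} → Decidable A → Dec (∀ S → A S)
allSubsets? A? = map′
  (λ none S → decidable-stable (A? S) (λ ¬p → none (S , ¬p)))
  (λ p (S , ¬p) → ¬p (p S))
  (¬? (anySubset? (¬? ∘ A?)))

-- The height-three poset and its ten proper tubes.

-- The minimal elements are 0 and 1. The singleton bundle {2}, with ∂2 = {0}, only serves to give
-- the bundles {3, 4} and {5, 6} different boundaries {0, 1} and {0, 1, 2}.
downset : Fin 7 → Subset 7
downset = lookup
  ( (true  ∷ false ∷ false ∷ false ∷ false ∷ false ∷ false ∷ [])
  ∷ (false ∷ true  ∷ false ∷ false ∷ false ∷ false ∷ false ∷ [])
  ∷ (true  ∷ false ∷ true  ∷ false ∷ false ∷ false ∷ false ∷ [])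
  ∷ (true  ∷ true  ∷ false ∷ true  ∷ false ∷ false ∷ false ∷ [])
  ∷ (true  ∷ true  ∷ false ∷ false ∷ true  ∷ false ∷ false ∷ [])
  ∷ (true  ∷ true  ∷ true  ∷ false ∷ false ∷ true  ∷ false ∷ [])
  ∷ (true  ∷ true  ∷ true  ∷ false ∷ false ∷ false ∷ true  ∷ [])
  ∷ [])

prismPoset : FinPoset
prismPoset = record
  { n       = 7
  ; _≼_     = _≤′_
  ; refl≼   = from-yes (all? λ x → (x ≤′ x) Bool.≟ true)
  ; antisym = from-yes (all? λ x → all? λ y →
      ((x ≤′ y) Bool.≟ true) →-dec (((y ≤′ x) Bool.≟ true) →-dec (x ≟ y)))
  ; trans≼  = from-yes (all? λ x → all? λ y → all? λ z →
      ((x ≤′ y) Bool.≟ true) →-dec (((y ≤′ z) Bool.≟ true) →-dec ((x ≤′ z) Bool.≟ true)))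
  }
  where
  _≤′_ : Fin 7 → Fin 7 → Bool
  y ≤′ x = lookup (downset x) y

-- c runs cyclically through the choices of nonempty subsets of {3, 4} and {5, 6}, not both full.
prismTube : Label → Subset 7
prismTube a     = true ∷ false ∷ true ∷ false ∷ false ∷ false ∷ false ∷ []
prismTube b     = false ∷ true ∷ false ∷ false ∷ false ∷ false ∷ false ∷ []
prismTube (c i) = true ∷ true ∷ true ∷ lookup
  ( (true  ∷ false ∷ true  ∷ false ∷ [])
  ∷ (true  ∷ false ∷ true  ∷ true  ∷ [])
  ∷ (true  ∷ false ∷ false ∷ true  ∷ [])
  ∷ (true  ∷ true  ∷ false ∷ true  ∷ [])
  ∷ (false ∷ true  ∷ false ∷ true  ∷ [])
  ∷ (false ∷ true  ∷ true  ∷ true  ∷ [])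
  ∷ (false ∷ true  ∷ true  ∷ false ∷ [])
  ∷ (true  ∷ true  ∷ true  ∷ false ∷ [])
  ∷ []) i

prismTube-Filled : ∀ l → Filled prismPoset (prismTube l)
prismTube-Filled = from-yes (allLabels? λ l → Filled? prismPoset (prismTube l))

-- A check of all 128 subsets. With `prismTube-Connected` it shows that every proper filled set of
-- this poset is a tube.
prismTube-complete : ∀ S → Filled prismPoset S → S ≢ ⊤ → ∃ λ l → S ≡ prismTube l
prismTube-complete = from-yes (allSubsets? λ S →
  Filled? prismPoset S →-dec (¬? (S ≟ₛ ⊤) →-dec anyLabel? λ l → S ≟ₛ prismTube l))

prism-adjacent⇒Compatible : ∀ k l → adjacent k l ≡ true → Compatible prismPoset (prismTube k) (prismTube l)
prism-adjacent⇒Compatible = from-yes (allLabels? λ k → allLabels? λ l →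
  (adjacent k l Bool.≟ true) →-dec Compatible? prismPoset (prismTube k) (prismTube l))

prism-Compatible⇒adjacent : ∀ k l → Compatible prismPoset (prismTube k) (prismTube l) → adjacent k l ≡ true
prism-Compatible⇒adjacent = from-yes (allLabels? λ k → allLabels? λ l →
  Compatible? prismPoset (prismTube k) (prismTube l) →-dec (adjacent k l Bool.≟ true))

prismTube-root : Label → Fin 7
prismTube-root b = suc zero
prismTube-root _ = zero

prismTube-Connected : ∀ l → Connected prismPoset (prismTube l)
prismTube-Connected l = rooted⇒Connected prismPoset (prismTube-root l) (λ {x} x∈ →
  -- Two edges are enough: in each `c i`, 1 reaches 0 through an element of {3, 4}, and 5 and 6
  -- reach 0 through 2.
  reach⇒path l 2 x (from-yes (allLabels? λ l → all? λ x → (x ∈? prismTube l) →-dec reach? l 2 x) l x x∈))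
  where
  Reach : Label → ℕ → Fin 7 → Set
  Reach l zero    x = x ∈ prismTube l × x ≡ prismTube-root l
  Reach l (suc k) x = Reach l zero x ⊎
    (x ∈ prismTube l × ∃ λ y → HasseAdj prismPoset x y × Reach l k y)

  reach? : ∀ l k x → Dec (Reach l k x)
  reach? l zero    x = (x ∈? prismTube l) ×-dec (x ≟ prismTube-root l)
  reach? l (suc k) x = reach? l zero x ⊎-dec
    ((x ∈? prismTube l) ×-dec any? λ y → HasseAdj? prismPoset x y ×-dec reach? l k y)

  reach⇒path : ∀ l k x → Reach l k x → PathIn prismPoset (prismTube l) x (prismTube-root l)
  reach⇒path l zero    x (x∈ , refl)           = here x∈
  reach⇒path l (suc k) x (inj₁ (x∈ , refl))    = here x∈
  reach⇒path l (suc k) x (inj₂ (x∈ , y , xy , r)) = step x∈ xy (reach⇒path l k y r)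

prismTube-Proper : ∀ l → ProperTube prismPoset (prismTube l)
prismTube-Proper l = (prismTube-Filled l , prismTube-Connected l) ,
  from-yes (allLabels? λ l → ¬? (prismTube l ≟ₛ ⊤)) l

prismTube-injective : ∀ k l → prismTube k ≡ prismTube l → k ≡ l
prismTube-injective = from-yes (allLabels? λ k → allLabels? λ l →
  (prismTube k ≟ₛ prismTube l) →-dec (k ≟ₗ l))

-- Distances on the 8-cycle.

Far : Fin 8 → Fin 8 → Set
Far i j = ∀ k → adjacent k (c i) ≡ true → adjacent k (c j) ≡ true → k ≡ a ⊎ k ≡ b

far? : ∀ i j → Dec (Far i j)
far? i j = allLabels? λ k → (adjacent k (c i) Bool.≟ true) →-dec
  ((adjacent k (c j) Bool.≟ true) →-dec ((k ≟ₗ a) ⊎-dec (k ≟ₗ b)))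

far-+3 : ∀ i → Far i (next (next (next i)))
far-+3 = from-yes (all? λ i → far? i (next (next (next i))))

far-+4 : ∀ i → Far i (next (next (next (next i))))
far-+4 = from-yes (all? λ i → far? i (next (next (next (next i)))))

far-+5 : ∀ i → Far i (next (next (next (next (next i)))))
far-+5 = from-yes (all? λ i → far? i (next (next (next (next (next i))))))

adjacent-refl : ∀ k → adjacent k k ≡ true
adjacent-refl = from-yes (allLabels? λ k → adjacent k k Bool.≟ true)

Far⇒¬adjacent : ∀ {i j} → Far i j → adjacent (c i) (c j) ≢ true
Far⇒¬adjacent {i} far ij with far (c i) (adjacent-refl (c i)) ij
... | inj₁ ()
... | inj₂ ()

adjacent-next : ∀ i → adjacent (c i) (c (next i)) ≡ true
adjacent-next = from-yes (all? λ i → adjacent (c i) (c (next i)) Bool.≟ true)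

next-≢ : ∀ i → i ≢ next i
next-≢ = from-yes (all? λ i → ¬? (i ≟ next i))

neighbours-next : ∀ i k → adjacent k (c (next i)) ≡ true →
  (k ≡ a ⊎ k ≡ b) ⊎ (k ≡ c i ⊎ (k ≡ c (next i) ⊎ k ≡ c (next (next i))))
neighbours-next = from-yes (all? λ i → allLabels? λ k →
  (adjacent k (c (next i)) Bool.≟ true) →-dec (((k ≟ₗ a) ⊎-dec (k ≟ₗ b)) ⊎-dec
    ((k ≟ₗ c i) ⊎-dec ((k ≟ₗ c (next i)) ⊎-dec (k ≟ₗ c (next (next i)))))))

-- Provides the test tube of `far-smalls`: a tube of the cycle that cannot lie in the join of the
-- small tubes `c i` and `c j`.
nonadjacent-third : ∀ i j → ∃ λ k → adjacent (c k) (c i) ≢ true × k ≢ j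
nonadjacent-third = from-yes (all? λ i → all? λ j → any? λ k →
  ¬? (adjacent (c k) (c i) Bool.≟ true) ×-dec ¬? (k ≟ j))

-- Labelled tube complexes and their transport.

-- The tube complex of Q is the join of two isolated points a, b with the 8-cycle c.
record PrismLabelling (Q : FinPoset) : Set where
  open FinPoset Q
  field
    tube        : Label → Subset n
    tube-Proper : ∀ l → ProperTube Q (tube l)
    label       : ∀ S → ProperTube Q S → ∃ λ l → S ≡ tube l
    injective   : ∀ k l → tube k ≡ tube l → k ≡ l
    adjacent⇒   : ∀ k l → adjacent k l ≡ true → Compatible Q (tube k) (tube l)
    ⇒adjacent   : ∀ k l → Compatible Q (tube k) (tube l) → adjacent k l ≡ true

prismPoset-labelling : PrismLabelling prismPoset
prismPoset-labelling = record
  { tube        = prismTube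
  ; tube-Proper = prismTube-Proper
  ; label       = λ S ((fS , _) , S≢⊤) → prismTube-complete S fS S≢⊤
  ; injective   = prismTube-injective
  ; adjacent⇒   = prism-adjacent⇒Compatible
  ; ⇒adjacent   = prism-Compatible⇒adjacent
  }

transport : ∀ P Q → TubingIso P Q → PrismLabelling Q → PrismLabelling P
transport P Q iso L = record
  { tube        = tube
  ; tube-Proper = tube-Proper
  ; label       = label
  ; injective   = λ k l eq → L.injective k l
      (Corresponds-unique P Q iso (L.tube-Proper l) (corr l)
        (subst (λ S → Corresponds P Q iso S (L.tube k)) eq (corr k)))
  ; adjacent⇒   = λ k l kl → Corresponds-Compatible Q P iso⁻¹
      (L.tube-Proper k) (L.tube-Proper l) (corr⁻¹ k) (corr⁻¹ l) (L.adjacent⇒ k l kl)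
  ; ⇒adjacent   = λ k l comp → L.⇒adjacent k l
      (Corresponds-Compatible P Q iso (tube-Proper k) (tube-Proper l) (corr k) (corr l) comp)
  }
  where
  module L = PrismLabelling L

  iso⁻¹ = TubingIso-sym P Q iso

  matched : ∀ l → ∃ λ S → ProperTube P S × Corresponds Q P iso⁻¹ (L.tube l) S
  matched l = match Q P iso⁻¹ (L.tube-Proper l)

  tube : Label → Subset (FinPoset.n P)
  tube l = proj₁ (matched l)

  tube-Proper : ∀ l → ProperTube P (tube l)
  tube-Proper l = proj₁ (proj₂ (matched l))

  corr⁻¹ : ∀ l → Corresponds Q P iso⁻¹ (L.tube l) (tube l)
  corr⁻¹ l = proj₂ (proj₂ (matched l))

  corr : ∀ l → Corresponds P Q iso (tube l) (L.tube l)
  corr l = Corresponds-swap Q P iso⁻¹ (corr⁻¹ l)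

  label : ∀ S → ProperTube P S → ∃ λ l → S ≡ tube l
  -- Match `S` with a tube of `Q` and take the label of that tube; `S` and `tube l` then both
  -- correspond to `L.tube l`, so uniqueness applies.
  label S tS = l , Corresponds-unique Q P iso⁻¹ (tube-Proper l) (corr⁻¹ l)
    (Corresponds-swap P Q iso (subst (Corresponds P Q iso S) R≡ S~R))
    where
    matched⁻¹ = match P Q iso tS
    S~R       = proj₂ (proj₂ matched⁻¹)
    labelled  = L.label (proj₁ matched⁻¹) (proj₁ (proj₂ matched⁻¹))
    l         = proj₁ labelled
    R≡        = proj₂ labelled

-- Posets of height at most two.

module HeightTwo (Q : FinPoset) (h : Height≤2 Q) where
  open FinPoset Q

  infix 4 _<_
  _<_ : El Q → El Q → Set
  _<_ = _≺_ Q

  <? : ∀ y x → Dec (y < x)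
  <? = ≺? Q

  Min : El Q → Set
  Min x = ∀ y → ¬ y < x

  below-Min : ∀ {y x} → y < x → Min y
  below-Min {y} {x} y<x z z<y = h z y x (z<y , y<x)

  Min-or-above : ∀ x → Min x ⊎ ∃ λ y → y < x
  Min-or-above x with any? (λ y → <? y x)
  ... | yes p = inj₂ p
  ... | no ¬p = inj₁ (λ y y<x → ¬p (y , y<x))

  <⇒Covers : ∀ {y x} → y < x → Covers Q y x
  <⇒Covers {y} {x} y<x = y<x , λ z p → h y z x p

  ≼⇒≡⊎< : ∀ {y x} → (y ≼ x) ≡ true → y ≡ x ⊎ y < x
  ≼⇒≡⊎< {y} {x} y≼x with y ≟ x
  ... | yes y≡x = inj₁ y≡x
  ... | no y≢x  = inj₂ (y≼x , y≢x)

  lower-from-< : ∀ {M : El Q → Set} → (∀ {x y} → y < x → M x → M y) → IsLowerP Q M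
  lower-from-< down x y y≼x Mx with ≼⇒≡⊎< y≼x
  ... | inj₁ refl = Mx
  ... | inj₂ y<x  = down y<x Mx

  InBundle-refl : ∀ {x} → InBundle Q x x
  InBundle-refl z = id , id

  InBundle-Min : ∀ {x y} → Min x → InBundle Q x y → Min y
  InBundle-Min mx xy z z<y = mx z (proj₁ (xy z) z<y)

  Min-InBundle : ∀ {x y} → Min x → Min y → InBundle Q x y
  Min-InBundle mx my z = (λ z<y → contradiction z<y (my z)) , λ z<x → contradiction z<x (mx z)

  -- Minimal elements have empty boundary and form one bundle, which every filled set must meet. The
  -- element `x` witnesses that the poset is nonempty.
  Filled-Min : ∀ {S} x → Filled Q S → ∃ λ v → v ∈ S × Min v
  Filled-Min {S} x fS with Min-or-above x
  ... | inj₁ mx = let (v , v∈ , xv) = proj₂ fS x (λ y y<x → contradiction y<x (mx y))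
                  in v , v∈ , InBundle-Min mx xv
  ... | inj₂ (y , y<x) =
    let my = below-Min y<x
        (v , v∈ , yv) = proj₂ fS y (λ z z<y → contradiction z<y (my z))
    in v , v∈ , InBundle-Min my yv

  Proper-Min : ∀ {S} → ProperTube Q S → ∃ λ v → v ∈ S × Min v
  Proper-Min ((fS , _) , S≢⊤) = Filled-Min (proj₁ (≢⊤⇒∃∉ S≢⊤)) fS

  -- Stems and small tubes.

  -- A stem {v, z} is an inclusion-minimal tube: a minimal element v together with
  -- one z such that ∂z = {v}; if there is no such z, then z = v.
  IsStem : El Q → El Q → Set
  IsStem v z = Min v ×
    ((z ≡ v × (∀ x → v < x → ¬ (∀ y → y < x → y ≡ v))) ⊎ (v < z × (∀ y → y < z → y ≡ v)))

  ∈stem? : ∀ (v z : El Q) → Decidable (λ x → x ≡ v ⊎ x ≡ z)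
  ∈stem? v z x = (x ≟ v) ⊎-dec (x ≟ z)

  abstract
    stem : El Q → El Q → Subset n
    stem v z = ⟦ ∈stem? v z ⟧

    ∈stem⁺ : ∀ {v z x : El Q} → x ≡ v ⊎ x ≡ z → x ∈ stem v z
    ∈stem⁺ {v} {z} = ∈⟦⟧⁺ (∈stem? v z)

    ∈stem⁻ : ∀ {v z x : El Q} → x ∈ stem v z → x ≡ v ⊎ x ≡ z
    ∈stem⁻ {v} {z} = ∈⟦⟧⁻ (∈stem? v z)

  stem-⊆ : ∀ {v z S} → v ∈ S → z ∈ S → stem v z ⊆ S
  stem-⊆ v∈ z∈ x∈ with ∈stem⁻ x∈
  ... | inj₁ refl = v∈
  ... | inj₂ refl = z∈

  stem-Min : ∀ {v z x} → IsStem v z → Min x → x ∈ stem v z → x ≡ v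
  stem-Min (mv , alt) mx x∈ with ∈stem⁻ x∈ | alt
  ... | inj₁ x≡v  | _               = x≡v
  ... | inj₂ refl | inj₁ (z≡v , _)  = z≡v
  ... | inj₂ refl | inj₂ (v<z , _)  = contradiction v<z (mx _)

  stem-nonMin : ∀ {v z x y} → IsStem v z → y < x → x ∈ stem v z → x ≡ z × (∀ y → y < x → y ≡ v)
  stem-nonMin (mv , alt) y<x x∈ with ∈stem⁻ x∈ | alt
  ... | inj₁ refl | _               = contradiction y<x (mv _)
  ... | inj₂ refl | inj₁ (refl , _) = contradiction y<x (mv _)
  ... | inj₂ refl | inj₂ (_ , only) = refl , only

  -- For fixed `v` the two alternatives of `IsStem` exclude each other: one exhibits an element with
  -- boundary {v}, the other denies that any exists.
  stem-unique : ∀ {v z z'} → IsStem v z → IsStem v z' → z' ∈ stem v z → z' ≡ z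
  stem-unique (_ , alt) (_ , alt') z'∈ with ∈stem⁻ z'∈ | alt' | alt
  ... | inj₂ z'≡z | _                    | _                    = z'≡z
  ... | inj₁ refl | inj₂ (v<v , _)       | _                    = contradiction refl (proj₂ v<v)
  ... | inj₁ refl | inj₁ _               | inj₁ (z≡v , _)       = sym z≡v
  ... | inj₁ refl | inj₁ (_ , none)      | inj₂ (v<z , only)    = contradiction only (none _ v<z)

  -- An element whose boundary lies in the stem has boundary empty or {v}. Its bundle is met by `v`
  -- in the first case and by `z` in the second; if `z` is `v`, the second case does not occur.
  stem-Filled : ∀ {v z} → IsStem v z → Filled Q (stem v z)
  stem-Filled {v} {z} st@(mv , alt) =
    lower-from-< (λ y<x x∈ → ∈stem⁺ (inj₁ (proj₂ (stem-nonMin st y<x x∈) _ y<x))) , fill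
    where
    fill : ∀ x → BoundaryIn Q x (_∈ stem v z) → ∃ λ y → y ∈ stem v z × InBundle Q x y
    fill x ∂x with Min-or-above x
    ... | inj₁ mx = v , ∈stem⁺ (inj₁ refl) , Min-InBundle mx mv
    ... | inj₂ (y , y<x) = filler alt
      where
      ∂x≡v : ∀ y → y < x → y ≡ v
      ∂x≡v y y<x = stem-Min st (below-Min y<x) (∂x y y<x)
      v<x : v < x
      v<x = subst (_< x) (∂x≡v y y<x) y<x
      filler : _ → ∃ λ y → y ∈ stem v z × InBundle Q x y
      filler (inj₁ (_ , none))     = contradiction ∂x≡v (none x v<x)
      filler (inj₂ (v<z , only))   = z , ∈stem⁺ (inj₂ refl) , λ w →
        (λ w<z → subst (_< x) (sym (only w w<z)) v<x) ,
        (λ w<x → subst (_< z) (sym (∂x≡v w w<x)) v<z)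

  stem-rooted : ∀ {v z S} → IsStem v z → v ∈ S → z ∈ S → ∀ {x} → x ∈ stem v z → PathIn Q S x v
  stem-rooted (_ , alt) v∈ z∈ x∈ with ∈stem⁻ x∈ | alt
  ... | inj₁ refl | _               = here v∈
  ... | inj₂ refl | inj₁ (refl , _) = here v∈
  ... | inj₂ refl | inj₂ (v<z , _)  = step z∈ (inj₂ (<⇒Covers v<z)) (here v∈)

  stem-IsTube : ∀ {v z} → IsStem v z → IsTube Q (stem v z)
  stem-IsTube {v} st = stem-Filled st ,
    rooted⇒Connected Q v (stem-rooted st (∈stem⁺ (inj₁ refl)) (∈stem⁺ (inj₂ refl)))

  -- If some `x` has boundary {v}, filledness puts a member of its bundle into `S`, and this member
  -- serves as `z`.
  stem-in : ∀ {S v} → Filled Q S → v ∈ S → Min v → ∃ λ z → z ∈ S × IsStem v z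
  stem-in {S} {v} fS v∈ mv
    with any? (λ x → <? v x ×-dec all? λ y → <? y x →-dec (y ≟ v))
  ... | no none = v , v∈ , mv , inj₁ (refl , λ x v<x only → none (x , v<x , only))
  ... | yes (x , v<x , only) =
    let (z , z∈ , xz) = proj₂ fS x (λ y y<x → subst (_∈ S) (sym (only y y<x)) v∈)
    in z , z∈ , mv , inj₂ (proj₂ (xz v) v<x , λ y y<z → only y (proj₁ (xz y) y<z))

  stem-⊆-≡ : ∀ {v z w y} → IsStem v z → IsStem w y → stem w y ⊆ stem v z → stem w y ≡ stem v z
  stem-⊆-≡ st sw sub with stem-Min st (proj₁ sw) (sub (∈stem⁺ (inj₁ refl)))
  ... | refl with stem-unique st sw (sub (∈stem⁺ (inj₂ refl)))
  ... | refl = refl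

  Small : Subset n → Set
  Small S = ∃₂ λ v z → IsStem v z × S ≡ stem v z

  Small-⊆-≡ : ∀ {S R} → Small S → Small R → R ⊆ S → R ≡ S
  Small-⊆-≡ (_ , _ , st , refl) (_ , _ , sw , refl) = stem-⊆-≡ st sw

  small-at : ∀ {S v} → Filled Q S → v ∈ S → Min v → ∃ λ R → Small R × R ⊆ S × v ∈ R
  small-at fS v∈ mv with stem-in fS v∈ mv
  ... | z , z∈ , st = stem _ z , (_ , z , st , refl) , stem-⊆ v∈ z∈ , ∈stem⁺ (inj₁ refl)

  TwoSmalls : Subset n → Set
  TwoSmalls S = ∃₂ λ R R' → (Small R × R ⊆ S) × (Small R' × R' ⊆ S) × R ≢ R'

  -- Take a stem at a minimal `v` of `S` and an element `y` of `S` outside it. A second stem is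
  -- found at `y` if `y` is minimal, and at any minimal `w` other than `v` below `y`.
  Small-or-TwoSmalls : ∀ {S} → ProperTube Q S → Small S ⊎ TwoSmalls S
  Small-or-TwoSmalls {S} tS@((fS , _) , _) with Proper-Min tS
  ... | v , v∈ , mv with stem-in fS v∈ mv
  ... | z , z∈ , st with S ⊆? stem v z
  ... | yes S⊆ = inj₁ (v , z , st , ⊆-antisym S⊆ (stem-⊆ v∈ z∈))
  ... | no S⊈ with ⊈⇒∃∉ S⊈
  ... | y , y∈ , y∉ = inj₂ (stem v z , _ , (((v , z , st , refl)) , stem-⊆ v∈ z∈) , proj₁ (proj₂ other) , proj₂ (proj₂ other))
    where
    other : ∃ λ R → (Small R × R ⊆ S) × stem v z ≢ R
    other with Min-or-above y
    ... | inj₁ my with small-at fS y∈ my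
    ...   | R , sR , R⊆ , y∈R = R , (sR , R⊆) , λ { refl → y∉ y∈R }
    other | inj₂ (u , u<y) with all? (λ w → <? w y →-dec (w ≟ v))
    -- The boundary of `y` is {v}, so `y` is another possible tip over the same `v`.
    ...   | yes only = stem v y ,
              ((v , y , (mv , inj₂ (subst (_< y) (only u u<y) u<y , only)) , refl) , stem-⊆ v∈ y∈) ,
              λ eq → y∉ (subst (y ∈_) (sym eq) (∈stem⁺ (inj₂ refl)))
    ...   | no ¬only with any? (λ w → <? w y ×-dec ¬? (w ≟ v))
    ...     | no none = contradiction (λ w w<y → decidable-stable (w ≟ v) (λ w≢v → none (w , w<y , w≢v))) ¬only
    ...     | yes (w , w<y , w≢v) with small-at fS (Filled-lower Q fS w<y y∈) (below-Min w<y)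
    ...       | R , sR , R⊆ , w∈R = R , (sR , R⊆) ,
                  λ { refl → w≢v (stem-Min st (below-Min w<y) w∈R) }

  ∪-lower : ∀ {S R} → Filled Q S → Filled Q R → ∀ {x y} → y < x → x ∈ S ∪ R → y ∈ S ∪ R
  ∪-lower {S} {R} fS fR y<x x∈ = x∈p∪q⁺ ([ inj₁ ∘ Filled-lower Q fS y<x , inj₂ ∘ Filled-lower Q fR y<x ]′ (x∈p∪q⁻ S R x∈))

  -- Joins of incompatible tubes.

  Clash : Subset n → Subset n → Set
  Clash S R = (∃ λ p → p ∈ S × p ∈ R) ⊎
    (∃ λ x → BoundaryIn Q x (_∈ S ∪ R) × ¬ (∃ λ y → y ∈ S ∪ R × InBundle Q x y))

  -- Disjoint sets with filled union are compatible, so one of these two conditions must fail.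
  -- `Clash` is only a consequence of incompatibility: nested sets share points too.
  ¬Compatible⇒Clash : ∀ {S R} → Filled Q S → Filled Q R → ¬ Compatible Q S R → Clash S R
  ¬Compatible⇒Clash {S} {R} fS fR ¬comp with any? (λ p → (p ∈? S) ×-dec (p ∈? R))
  ... | yes shared = inj₁ shared
  ... | no disjoint with any? (λ x → BoundaryIn? Q (_∈? S ∪ R) x ×-dec ¬? (meetsBundle? Q (_∈? S ∪ R) x))
  ...   | yes open-bundle = inj₂ open-bundle
  ...   | no none = contradiction
    (inj₁ (λ x p → disjoint (x , p)) , lower-from-< (∪-lower fS fR) ,
     λ x ∂x → decidable-stable (meetsBundle? Q (_∈? S ∪ R) x) (λ ¬m → none (x , ∂x , ¬m)))
    ¬comp

  -- Two stems over different minimal elements, glued by an element `e` whose boundary is exactly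
  -- {v, w}.
  module Join {v z w y e : El Q} (st : IsStem v z) (sw : IsStem w y)
              (v≢w : v ≢ w) (v<e : v < e) (w<e : w < e) (only : ∀ u → u < e → u ≡ v ⊎ u ≡ w) where

    ∈join? : Decidable (λ x → (x ∈ stem v z ⊎ x ∈ stem w y) ⊎ x ≡ e)
    ∈join? x = ((x ∈? stem v z) ⊎-dec (x ∈? stem w y)) ⊎-dec (x ≟ e)

    join : Subset n
    join = ⟦ ∈join? ⟧

    ∈join⁻ : ∀ {x} → x ∈ join → (x ∈ stem v z ⊎ x ∈ stem w y) ⊎ x ≡ e
    ∈join⁻ = ∈⟦⟧⁻ ∈join?

    stem₁⊆join : stem v z ⊆ join
    stem₁⊆join = ∈⟦⟧⁺ ∈join? ∘ inj₁ ∘ inj₁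

    stem₂⊆join : stem w y ⊆ join
    stem₂⊆join = ∈⟦⟧⁺ ∈join? ∘ inj₁ ∘ inj₂

    e∈join : e ∈ join
    e∈join = ∈⟦⟧⁺ ∈join? (inj₂ refl)

    v∈ : v ∈ join
    v∈ = stem₁⊆join (∈stem⁺ (inj₁ refl))

    w∈ : w ∈ join
    w∈ = stem₂⊆join (∈stem⁺ (inj₁ refl))

    join-⊆ : ∀ {S} → stem v z ⊆ S → stem w y ⊆ S → e ∈ S → join ⊆ S
    join-⊆ s⊆ t⊆ e∈ x∈ with ∈join⁻ x∈
    ... | inj₁ (inj₁ p) = s⊆ p
    ... | inj₁ (inj₂ p) = t⊆ p
    ... | inj₂ refl     = e∈

    join-Min : ∀ {x} → Min x → x ∈ join → x ≡ v ⊎ x ≡ w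
    join-Min mx x∈ with ∈join⁻ x∈
    ... | inj₁ (inj₁ p) = inj₁ (stem-Min st mx p)
    ... | inj₁ (inj₂ p) = inj₂ (stem-Min sw mx p)
    ... | inj₂ refl     = contradiction v<e (mx v)

    join-top : ∀ {x} → v < x → w < x → x ∈ join → x ≡ e
    join-top v<x w<x x∈ with ∈join⁻ x∈
    ... | inj₁ (inj₁ p) = contradiction (sym (proj₂ (stem-nonMin st v<x p) _ w<x)) v≢w
    ... | inj₁ (inj₂ p) = contradiction (proj₂ (stem-nonMin sw v<x p) _ v<x) v≢w
    ... | inj₂ x≡e      = x≡e

    join-Filled : Filled Q join
    join-Filled = lower-from-< lower , fill
      where
      lower : ∀ {x u} → u < x → x ∈ join → u ∈ join
      lower u<x x∈ with ∈join⁻ x∈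
      ... | inj₁ (inj₁ p) = stem₁⊆join (Filled-lower Q (stem-Filled st) u<x p)
      ... | inj₁ (inj₂ p) = stem₂⊆join (Filled-lower Q (stem-Filled sw) u<x p)
      ... | inj₂ refl with only _ u<x
      ...   | inj₁ refl = v∈
      ...   | inj₂ refl = w∈

      fill : ∀ x → BoundaryIn Q x (_∈ join) → ∃ λ y → y ∈ join × InBundle Q x y
      -- If both `v` and `w` lie below `x`, then `x` is in the bundle of `e`; otherwise the boundary
      -- of `x` lies in one of the stems, which is already filled.
      fill x ∂x with <? v x | <? w x
      ... | yes v<x | yes w<x = e , e∈join , λ u →
        (λ u<e → [ (λ { refl → v<x }) , (λ { refl → w<x }) ]′ (only u u<e)) ,
        (λ u<x → [ (λ { refl → v<e }) , (λ { refl → w<e }) ]′ (join-Min (below-Min u<x) (∂x u u<x)))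
      ... | _ | no w≮x =
        let (u , u∈ , xu) = proj₂ (stem-Filled st) x λ u u<x →
              [ (λ { refl → ∈stem⁺ (inj₁ refl) }) , (λ { refl → contradiction u<x w≮x }) ]′
                (join-Min (below-Min u<x) (∂x u u<x))
        in u , stem₁⊆join u∈ , xu
      ... | no v≮x | yes _ =
        let (u , u∈ , xu) = proj₂ (stem-Filled sw) x λ u u<x →
              [ (λ { refl → contradiction u<x v≮x }) , (λ { refl → ∈stem⁺ (inj₁ refl) }) ]′
                (join-Min (below-Min u<x) (∂x u u<x))
        in u , stem₂⊆join u∈ , xu

    join-IsTube : IsTube Q join
    join-IsTube = join-Filled , rooted⇒Connected Q e path
      where
      path : ∀ {x} → x ∈ join → PathIn Q join x e
      path x∈ with ∈join⁻ x∈
      ... | inj₁ (inj₁ p) = path-trans Q (stem-rooted st v∈ (stem₁⊆join (∈stem⁺ (inj₂ refl))) p)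
              (step v∈ (inj₁ (<⇒Covers v<e)) (here e∈join))
      ... | inj₁ (inj₂ p) = path-trans Q (stem-rooted sw w∈ (stem₂⊆join (∈stem⁺ (inj₂ refl))) p)
              (step w∈ (inj₁ (<⇒Covers w<e)) (here e∈join))
      ... | inj₂ refl     = here e∈join

    -- A filled `X` through `v` contains some stem at `v`. Its tip cannot be `e` or lie in the other
    -- stem, so `stem-unique` makes it `z`.
    stem₁⊆ : ∀ {X} → Filled Q X → X ⊆ join → v ∈ X → stem v z ⊆ X
    stem₁⊆ fX X⊆ v∈X with stem-in fX v∈X (proj₁ st)
    ... | z' , z'∈ , st' with ∈join⁻ (X⊆ z'∈)
    ...   | inj₁ (inj₁ p) = stem-⊆ v∈X (subst (_∈ _) (stem-unique st st' p) z'∈)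
    ...   | inj₁ (inj₂ p) = ⊥-elim (case proj₂ st' of λ where
              (inj₁ (refl , _)) → v≢w (stem-Min sw (proj₁ st) p)
              (inj₂ (v<z' , _)) → v≢w (proj₂ (stem-nonMin sw v<z' p) _ v<z'))
    ...   | inj₂ refl     = ⊥-elim (case proj₂ st' of λ where
              (inj₁ (refl , _)) → proj₂ v<e refl
              (inj₂ (_ , only')) → v≢w (sym (only' w w<e)))

  -- `J` is asked to be a tube, not a proper one, since it may be the whole poset.
  Joined : Subset n → Subset n → Set
  Joined S R = ∃ λ J → IsTube Q J × (S ⊆ J × R ⊆ J) ×
    (∀ X → ProperTube Q X → X ⊆ J → (X ≡ S ⊎ X ≡ R) ⊎ X ≡ J)

  join-⊆-stems : ∀ {v z w y e} (st : IsStem v z) (sw : IsStem w y) (v≢w : v ≢ w)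
    (v<e : v < e) (w<e : w < e) (only : ∀ u → u < e → u ≡ v ⊎ u ≡ w) → Joined (stem v z) (stem w y)
  join-⊆-stems {v} {z} {w} {y} {e} st sw v≢w v<e w<e only =
    J.join , J.join-IsTube , (J.stem₁⊆join , J.stem₂⊆join) , inside
    where
    module J  = Join st sw v≢w v<e w<e only
    -- The mirror image makes the facts about the first stem available for the second.
    module J′ = Join sw st (v≢w ∘ sym) w<e v<e (λ u → swap ∘ only u)

    J⊆J′ : J.join ⊆ J′.join
    J⊆J′ = J.join-⊆ J′.stem₂⊆join J′.stem₁⊆join J′.e∈join

    inside : ∀ X → ProperTube Q X → X ⊆ J.join → (X ≡ stem v z ⊎ X ≡ stem w y) ⊎ X ≡ J.join
    inside X tX@((fX , _) , _) X⊆ with v ∈? X | w ∈? X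
    ... | yes v∈X | yes w∈X = inj₂ (⊆-antisym X⊆
      (J.join-⊆ (J.stem₁⊆ fX X⊆ v∈X) (J′.stem₁⊆ fX (⊆-trans X⊆ J⊆J′) w∈X) e∈X))
      where
      e∈X : e ∈ X
      -- `X` contains the boundary of `e` and so meets its bundle; `e` is the only member of that
      -- bundle in the join.
      e∈X with proj₂ fX e (λ u u<e → [ (λ { refl → v∈X }) , (λ { refl → w∈X }) ]′ (only u u<e))
      ... | e' , e'∈ , ee' with J.join-top (proj₂ (ee' v) v<e) (proj₂ (ee' w) w<e) (X⊆ e'∈)
      ... | refl = e'∈
    ... | yes v∈X | no w∉X = inj₁ (inj₁ (⊆-antisym only-v (J.stem₁⊆ fX X⊆ v∈X)))
      where
      only-v : X ⊆ stem v z
      only-v x∈ with J.∈join⁻ (X⊆ x∈)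
      ... | inj₁ (inj₁ p) = p
      ... | inj₂ refl     = contradiction (Filled-lower Q fX w<e x∈) w∉X
      ... | inj₁ (inj₂ p) with Min-or-above _
      ...   | inj₁ mx = contradiction (subst (_∈ X) (stem-Min sw mx p) x∈) w∉X
      ...   | inj₂ (u , u<x) = contradiction
              (Filled-lower Q fX (subst (_< _) (proj₂ (stem-nonMin sw u<x p) u u<x) u<x) x∈) w∉X
    ... | no v∉X | _ = inj₁ (inj₂ (⊆-antisym only-w (J′.stem₁⊆ fX (⊆-trans X⊆ J⊆J′) w∈X)))
      where
      w∈X : w ∈ X
      w∈X with Proper-Min tX
      ... | u , u∈ , mu with J.join-Min mu (X⊆ u∈)
      ...   | inj₁ refl = contradiction u∈ v∉X
      ...   | inj₂ refl = u∈
      only-w : X ⊆ stem w y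
      only-w x∈ with J.∈join⁻ (X⊆ x∈)
      ... | inj₁ (inj₂ p) = p
      ... | inj₂ refl     = contradiction (Filled-lower Q fX v<e x∈) v∉X
      ... | inj₁ (inj₁ p) with Min-or-above _
      ...   | inj₁ mx = contradiction (subst (_∈ X) (stem-Min st mx p) x∈) v∉X
      ...   | inj₂ (u , u<x) = contradiction
              (Filled-lower Q fX (subst (_< _) (proj₂ (stem-nonMin st u<x p) u u<x) u<x) x∈) v∉X

  -- With a common `v`, the union is already filled and is connected through `v`. A filled subset
  -- contains `v` and at least one of the tips, which leaves only the three sets allowed.
  join-loops : ∀ {v z y} → IsStem v z → IsStem v y → Joined (stem v z) (stem v y)
  join-loops {v} {z} {y} st sy = J , (filled , rooted⇒Connected Q v path) , (s⊆ , t⊆) , inside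
    where
    J = stem v z ∪ stem v y

    s⊆ : stem v z ⊆ J
    s⊆ = p⊆p∪q (stem v y)

    t⊆ : stem v y ⊆ J
    t⊆ = q⊆p∪q (stem v z) (stem v y)

    v∈ : v ∈ J
    v∈ = s⊆ (∈stem⁺ (inj₁ refl))

    J-Min : ∀ {x} → Min x → x ∈ J → x ≡ v
    J-Min mx x∈ = [ stem-Min st mx , stem-Min sy mx ]′ (x∈p∪q⁻ _ _ x∈)

    filled : Filled Q J
    filled = lower-from-< (∪-lower (stem-Filled st) (stem-Filled sy)) , λ x ∂x →
      let (u , u∈ , xu) = proj₂ (stem-Filled st) x
            (λ u u<x → ∈stem⁺ (inj₁ (J-Min (below-Min u<x) (∂x u u<x))))
      in u , s⊆ u∈ , xu

    path : ∀ {x} → x ∈ J → PathIn Q J x v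
    path x∈ = [ stem-rooted st v∈ (s⊆ (∈stem⁺ (inj₂ refl)))
              , stem-rooted sy v∈ (t⊆ (∈stem⁺ (inj₂ refl))) ]′ (x∈p∪q⁻ _ _ x∈)

    grow : ∀ {z y X} → v ∈ X → z ∈ X → X ⊆ stem v z ∪ stem v y →
           X ≡ stem v z ⊎ X ≡ stem v z ∪ stem v y
    grow {z} {y} {X} v∈X z∈X X⊆ with y ∈? X
    ... | yes y∈X = inj₂ (⊆-antisym X⊆ (λ x∈ →
            [ stem-⊆ v∈X z∈X , stem-⊆ v∈X y∈X ]′ (x∈p∪q⁻ _ _ x∈)))
    ... | no y∉X  = inj₁ (⊆-antisym shrink (stem-⊆ v∈X z∈X))
      where
      shrink : X ⊆ stem v z
      shrink x∈ with x∈p∪q⁻ _ _ (X⊆ x∈)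
      ... | inj₁ p = p
      ... | inj₂ p with ∈stem⁻ p
      ...   | inj₁ x≡v  = ∈stem⁺ (inj₁ x≡v)
      ...   | inj₂ refl = contradiction x∈ y∉X

    inside : ∀ X → ProperTube Q X → X ⊆ J → (X ≡ stem v z ⊎ X ≡ stem v y) ⊎ X ≡ J
    inside X tX@((fX , _) , _) X⊆ with Proper-Min tX
    ... | u , u∈ , mu with J-Min mu (X⊆ u∈)
    ... | refl with stem-in fX u∈ mu
    ... | z' , z'∈ , st' with x∈p∪q⁻ (stem v z) (stem v y) (X⊆ z'∈)
    ... | inj₁ p = [ inj₁ ∘ inj₁ , inj₂ ]′ (grow u∈ (subst (_∈ X) (stem-unique st st' p) z'∈) X⊆)
    ... | inj₂ p = [ inj₁ ∘ inj₂ , (λ X≡ → inj₂ (trans X≡ (∪-comm _ _))) ]′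
      (grow u∈ (subst (_∈ X) (stem-unique sy st' p) z'∈)
        (λ x∈ → subst (_ ∈_) (∪-comm (stem v z) (stem v y)) (X⊆ x∈)))

  -- A point shared by stems over different minimal elements would force these to agree. So
  -- incompatibility gives an `e` whose bundle is unmet; both `v` and `w` lie below it, since
  -- otherwise one stem alone would meet the bundle.
  small-join : ∀ {S R} → Small S → Small R → ¬ Compatible Q S R → Joined S R
  small-join (v , z , st , refl) (w , y , sw , refl) ¬comp with v ≟ w
  ... | yes refl = join-loops st sw
  ... | no v≢w with ¬Compatible⇒Clash (stem-Filled st) (stem-Filled sw) ¬comp
  ...   | inj₁ (p , p∈s , p∈t) = ⊥-elim (case Min-or-above p of λ where
          (inj₁ mp) → v≢w (trans (sym (stem-Min st mp p∈s)) (stem-Min sw mp p∈t))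
          (inj₂ (u , u<p)) → v≢w (trans (sym (proj₂ (stem-nonMin st u<p p∈s) u u<p))
                                        (proj₂ (stem-nonMin sw u<p p∈t) u u<p)))
  ...   | inj₂ (e , ∂e , unmet) = join-⊆-stems st sw v≢w
          (decidable-stable (<? v e) λ v≮e → unmet (missing (stem-Filled sw) (λ p → x∈p∪q⁺ (inj₂ p)) λ u u<e →
            [ (λ { refl → contradiction u<e v≮e }) , (λ { refl → ∈stem⁺ (inj₁ refl) }) ]′ (only u u<e)))
          (decidable-stable (<? w e) λ w≮e → unmet (missing (stem-Filled st) (λ p → x∈p∪q⁺ (inj₁ p)) λ u u<e →
            [ (λ { refl → ∈stem⁺ (inj₁ refl) }) , (λ { refl → contradiction u<e w≮e }) ]′ (only u u<e)))
          only
    where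
    only : ∀ u → u < e → u ≡ v ⊎ u ≡ w
    only u u<e = [ inj₁ ∘ stem-Min st (below-Min u<e) , inj₂ ∘ stem-Min sw (below-Min u<e) ]′
      (x∈p∪q⁻ (stem v z) (stem w y) (∂e u u<e))

    missing : ∀ {T} → Filled Q T → T ⊆ stem v z ∪ stem w y → BoundaryIn Q e (_∈ T) →
              ∃ λ x → x ∈ stem v z ∪ stem w y × InBundle Q e x
    missing fT T⊆ ∂T = let (x , x∈ , ex) = proj₂ fT e ∂T in x , T⊆ x∈ , ex

  -- The substantial case is `X` disjoint from `J`. If the bundle of `x` is met in `J`, the boundary
  -- of `x` lies in `J` and avoids `X`, hence lies in `S`, and `S` itself meets the bundle.
  Compatible-inside : ∀ {S J X} → Filled Q S → Filled Q J → Filled Q X → S ⊆ J →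
    Compatible Q J X → ¬ (X ⊆ J) → Compatible Q S X
  Compatible-inside {S} {J} {X} fS fJ fX S⊆J (inj₂ (inj₁ J⊆X) , _) X⊈J =
    ⊆-Compatible Q (⊆-trans S⊆J J⊆X) fX
  Compatible-inside {S} {J} {X} fS fJ fX S⊆J (inj₂ (inj₂ X⊆J) , _) X⊈J = contradiction (λ {x} → X⊆J {x}) X⊈J
  Compatible-inside {S} {J} {X} fS fJ fX S⊆J (inj₁ disj , fJX) X⊈J =
    inj₁ (λ x (x∈S , x∈X) → disj x (S⊆J x∈S , x∈X)) , lower-from-< (∪-lower fS fX) , fill
    where
    fill : ∀ x → BoundaryIn Q x (_∈ S ∪ X) → ∃ λ y → y ∈ S ∪ X × InBundle Q x y
    fill x ∂x with proj₂ fJX x (λ u u<x → x∈p∪q⁺ ([ inj₁ ∘ S⊆J , inj₂ ]′ (x∈p∪q⁻ S X (∂x u u<x))))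
    ... | y , y∈ , xy with x∈p∪q⁻ J X y∈
    ...   | inj₂ y∈X = y , x∈p∪q⁺ (inj₂ y∈X) , xy
    ...   | inj₁ y∈J =
      let (y' , y'∈ , xy') = proj₂ fS x λ u u<x →
            [ id , (λ u∈X → contradiction (Filled-lower Q fJ (proj₂ (xy u) u<x) y∈J , u∈X) (disj u)) ]′
              (x∈p∪q⁻ S X (∂x u u<x))
      in y' , x∈p∪q⁺ (inj₁ y'∈) , xy'

  -- Saturating S ∪ R need not use e when the bundle of e already meets S ∪ R.
  avoiding-join : ∀ {S R e f} → IsTube Q S → IsTube Q R → ¬ Compatible Q S R →
    e ∉ S ∪ R → f ∈ S ∪ R → InBundle Q e f →
    ∃ λ J → ProperTube Q J × S ⊆ J × R ⊆ J
  avoiding-join {S} {R} {e} {f} tS@(fS , cS) tR@(fR , cR) ¬comp e∉ f∈ ef =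
    J , (((lower-from-< lower , fill) , connected) , λ J≡⊤ → e∉J (subst (e ∈_) (sym J≡⊤) ∈⊤)) , S⊆J , R⊆J
    where
    U = S ∪ R

    -- One round of additions suffices: added elements are nonminimal, while boundaries consist of
    -- minimal elements.
    Saturated : El Q → Set
    Saturated x = x ≢ e × (x ∈ U ⊎ ((∃ λ y → y < x) × BoundaryIn Q x (_∈ U)))

    saturated? : Decidable Saturated
    saturated? x = ¬? (x ≟ e) ×-dec ((x ∈? U) ⊎-dec ((any? λ y → <? y x) ×-dec BoundaryIn? Q (_∈? U) x))

    J = ⟦ saturated? ⟧

    e∉J : e ∉ J
    e∉J e∈ = proj₁ (∈⟦⟧⁻ saturated? e∈) refl

    U⊆J : U ⊆ J
    U⊆J x∈ = ∈⟦⟧⁺ saturated? ((λ { refl → e∉ x∈ }) , inj₁ x∈)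

    S⊆J : S ⊆ J
    S⊆J = U⊆J ∘ x∈p∪q⁺ ∘ inj₁

    R⊆J : R ⊆ J
    R⊆J = U⊆J ∘ x∈p∪q⁺ ∘ inj₂

    lower : ∀ {x y} → y < x → x ∈ J → y ∈ J
    lower y<x x∈ with ∈⟦⟧⁻ saturated? x∈
    ... | _ , inj₁ x∈U      = U⊆J (∪-lower fS fR y<x x∈U)
    ... | _ , inj₂ (_ , ∂x) = U⊆J (∂x _ y<x)

    fill : ∀ x → BoundaryIn Q x (_∈ J) → ∃ λ y → y ∈ J × InBundle Q x y
    fill x ∂x with Min-or-above x
    ... | inj₁ mx = let (y , y∈ , xy) = proj₂ fS x (λ u u<x → contradiction u<x (mx u)) in y , S⊆J y∈ , xy
    ... | inj₂ above with x ≟ e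
    ...   | yes refl = f , U⊆J f∈ , ef
    ...   | no x≢e   = x , ∈⟦⟧⁺ saturated? (x≢e , inj₂ (above , ∂x∈U)) , InBundle-refl
      where
      ∂x∈U : BoundaryIn Q x (_∈ U)
      ∂x∈U u u<x with ∈⟦⟧⁻ saturated? (∂x u u<x)
      ... | _ , inj₁ u∈U              = u∈U
      ... | _ , inj₂ ((t , t<u) , _)  = contradiction t<u (below-Min u<x t)

    root⇒Connected : ∀ r → (∀ {x} → x ∈ S → PathIn Q J x r) → (∀ {x} → x ∈ R → PathIn Q J x r) → Connected Q J
    root⇒Connected r fromS fromR = rooted⇒Connected Q r path
      where
      pathU : ∀ {x} → x ∈ U → PathIn Q J x r
      pathU x∈ = [ fromS , fromR ]′ (x∈p∪q⁻ S R x∈)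
      path : ∀ {x} → x ∈ J → PathIn Q J x r
      path x∈ with ∈⟦⟧⁻ saturated? x∈
      ... | _ , inj₁ x∈U                = pathU x∈U
      ... | _ , inj₂ ((y , y<x) , ∂x)   = step x∈ (inj₂ (<⇒Covers y<x)) (pathU (∂x y y<x))

    connected : Connected Q J
    connected with ¬Compatible⇒Clash fS fR ¬comp
    ... | inj₁ (p , p∈S , p∈R) = root⇒Connected p
      (λ x∈ → path-mono Q S⊆J (cS _ p x∈ p∈S)) (λ x∈ → path-mono Q R⊆J (cR _ p x∈ p∈R))
    ... | inj₂ (x , ∂x , unmet) = root⇒Connected x
      (λ u∈ → through S⊆J cS (meets fR (λ p → x∈p∪q⁺ (inj₂ p)) λ u u<x u∉S →
        [ (λ u∈S → contradiction u∈S u∉S) , id ]′ (x∈p∪q⁻ S R (∂x u u<x))) u∈)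
      (λ u∈ → through R⊆J cR (meets fS (λ p → x∈p∪q⁺ (inj₁ p)) λ u u<x u∉R →
        [ id , (λ u∈R → contradiction u∈R u∉R) ]′ (x∈p∪q⁻ S R (∂x u u<x))) u∈)
      where
      -- If nothing below `x` were in `T`, its boundary would lie in `T'`, and filledness of `T'`
      -- would meet the bundle of `x`.
      meets : ∀ {T T'} → Filled Q T' → T' ⊆ U → (∀ u → u < x → u ∉ T → u ∈ T') → ∃ λ u → u < x × u ∈ T
      meets {T} fT' T'⊆ other with any? (λ u → <? u x ×-dec (u ∈? T))
      ... | yes found = found
      ... | no none   = contradiction
        (let (y , y∈ , xy) = proj₂ fT' x (λ u u<x → other u u<x (λ u∈T → none (u , u<x , u∈T))) in y , T'⊆ y∈ , xy)
        unmet

      x≢e : x ≢ e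
      -- The bundle of `e` is met by `f`, that of `x` is not; so `x` survives in `J` and links `S`
      -- to `R`.
      x≢e refl = unmet (f , f∈ , ef)

      x∈J : (∃ λ y → y < x) → x ∈ J
      x∈J above = ∈⟦⟧⁺ saturated? (x≢e , inj₂ (above , ∂x))

      through : ∀ {T} → T ⊆ J → Connected Q T → (∃ λ u → u < x × u ∈ T) → ∀ {y} → y ∈ T → PathIn Q J y x
      through T⊆ cT (u , u<x , u∈T) y∈ = path-trans Q (path-mono Q T⊆ (cT _ u y∈ u∈T))
        (step (T⊆ u∈T) (inj₁ (<⇒Covers u<x)) (here (x∈J (u , u<x))))

  -- Contradiction from a labelling in height at most two.

  module _ (L : PrismLabelling Q) where
    open PrismLabelling L

    tube-Filled : ∀ l → Filled Q (tube l)
    tube-Filled l = proj₁ (proj₁ (tube-Proper l))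

    ⊆⇒adjacent : ∀ k l → tube k ⊆ tube l → adjacent k l ≡ true
    ⊆⇒adjacent k l k⊆l = ⇒adjacent k l (⊆-Compatible Q k⊆l (tube-Filled l))

    ⊇⇒adjacent : ∀ k l → tube l ⊆ tube k → adjacent k l ≡ true
    ⊇⇒adjacent k l l⊆k = ⇒adjacent k l (Compatible-sym Q (⊆-Compatible Q l⊆k (tube-Filled k)))

    Far⇒¬Compatible : ∀ {i j} → Far i j → ¬ Compatible Q (tube (c i)) (tube (c j))
    Far⇒¬Compatible far = Far⇒¬adjacent far ∘ ⇒adjacent _ _

    SmallLabel : Label → Set
    SmallLabel l = Small (tube l)

    TwoSmallLabels : Label → Set
    TwoSmallLabels l = ∃₂ λ k k' →
      (SmallLabel k × tube k ⊆ tube l) × (SmallLabel k' × tube k' ⊆ tube l) × k ≢ k'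

    small-label : ∀ {R l} → Small R → R ⊆ tube l → ∃ λ k → R ≡ tube k
    small-label {l = l} (v , z , st , refl) R⊆ =
      label _ (stem-IsTube st , ⊆-≢⊤ R⊆ (proj₂ (tube-Proper l)))

    small-or-two : ∀ l → SmallLabel l ⊎ TwoSmallLabels l
    small-or-two l with Small-or-TwoSmalls (tube-Proper l)
    ... | inj₁ sl = inj₁ sl
    ... | inj₂ (R , R' , (sR , R⊆) , (sR' , R'⊆) , R≢R') =
      pack (small-label sR R⊆) (small-label sR' R'⊆)
      where
      pack : (∃ λ k → R ≡ tube k) → (∃ λ k → R' ≡ tube k) → SmallLabel l ⊎ TwoSmallLabels l
      pack (k , refl) (k' , refl) = inj₂ (k , k' , (sR , R⊆) , (sR' , R'⊆) , λ { refl → R≢R' refl })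

    -- Small tubes inside a small tube are equal to it, so it cannot contain two different ones.
    small? : ∀ l → Dec (SmallLabel l)
    small? l with small-or-two l
    ... | inj₁ sl = yes sl
    ... | inj₂ (k , k' , (sk , k⊆) , (sk' , k'⊆) , k≢k') =
      no λ sl → k≢k' (injective k k' (trans (Small-⊆-≡ sl sk k⊆) (sym (Small-⊆-≡ sl sk' k'⊆))))

    -- If the join `J` is proper, it is a common neighbour of `c i` and `c j`, hence labelled `a` or
    -- `b`, and so compatible with the whole cycle. Then `Compatible-inside` makes a cycle tube
    -- outside `J` compatible with `c i`, although it was chosen nonadjacent.
    far-smalls : ∀ {i j} → Far i j → SmallLabel (c i) → ¬ SmallLabel (c j)
    far-smalls {i} {j} far si sj with small-join si sj (Far⇒¬Compatible far)
    ... | J , tJ , (i⊆J , j⊆J) , inside with J ≟ₛ ⊤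
    -- If `J` is everything, it contains `tube a`, which is none of the tubes allowed inside `J`.
    ...   | yes refl = ⊥-elim (case inside (tube a) (tube-Proper a) (λ _ → ∈⊤) of λ where
              (inj₁ (inj₁ eq)) → contradiction (injective a (c i) eq) λ ()
              (inj₁ (inj₂ eq)) → contradiction (injective a (c j) eq) λ ()
              (inj₂ eq)        → proj₂ (tube-Proper a) eq)
    ...   | no J≢⊤ = labelled (label J (tJ , J≢⊤))
      where
      labelled : ¬ (∃ λ k → J ≡ tube k)
      labelled (k , refl) with nonadjacent-third i j
      ... | x , x≁i , x≢j = outside k (far k (⊇⇒adjacent k (c i) i⊆J) (⊇⇒adjacent k (c j) j⊆J)) refl
        where
        x⊈J : ∀ k → k ≡ a ⊎ k ≡ b → J ≡ tube k → ¬ (tube (c x) ⊆ J)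
        x⊈J k k∈ab J≡ x⊆J with inside (tube (c x)) (tube-Proper (c x)) x⊆J | k∈ab
        ... | inj₁ (inj₁ eq) | _ with injective (c x) (c i) eq
        ...   | refl = x≁i (adjacent-refl (c x))
        x⊈J k k∈ab J≡ x⊆J | inj₁ (inj₂ eq) | _ = x≢j (c-injective (injective (c x) (c j) eq))
        x⊈J k k∈ab J≡ x⊆J | inj₂ eq | inj₁ refl = contradiction (injective (c x) a (trans eq J≡)) λ ()
        x⊈J k k∈ab J≡ x⊆J | inj₂ eq | inj₂ refl = contradiction (injective (c x) b (trans eq J≡)) λ ()

        k~x : ∀ k → k ≡ a ⊎ k ≡ b → adjacent k (c x) ≡ true
        k~x k (inj₁ refl) = refl
        k~x k (inj₂ refl) = refl

        outside : ∀ k → k ≡ a ⊎ k ≡ b → J ≡ tube k → ⊥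
        outside k k∈ab J≡ = x≁i (⇒adjacent (c x) (c i) (Compatible-sym Q
          (Compatible-inside (tube-Filled (c i)) (proj₁ tJ) (tube-Filled (c x)) i⊆J
            (subst (λ S → Compatible Q S (tube (c x))) (sym J≡) (adjacent⇒ k (c x) (k~x k k∈ab)))
            (x⊈J k k∈ab J≡))))

    -- Smallness of `a` and `b` themselves is not included; it is carried separately.
    SmallsAB : Label → Set
    SmallsAB l = (tube a ⊆ tube l × tube b ⊆ tube l) ×
      (∀ k → SmallLabel k → tube k ⊆ tube l → k ≡ a ⊎ k ≡ b)

    -- The middle tube contains two different small tubes. They are its neighbours in the graph, and
    -- `a` and `b` are the only neighbours not excluded.
    neighbours-smallsAB : ∀ i → ¬ SmallLabel (c i) → ¬ SmallLabel (c (next i)) →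
      ¬ SmallLabel (c (next (next i))) →
      (SmallLabel a × SmallLabel b) × SmallsAB (c (next i))
    neighbours-smallsAB i ¬s₀ ¬s₁ ¬s₂ = ordered (small-or-two (c (next i)))
      where
      only : ∀ k → SmallLabel k → tube k ⊆ tube (c (next i)) → k ≡ a ⊎ k ≡ b
      only k sk k⊆ with neighbours-next i k (⊆⇒adjacent k (c (next i)) k⊆)
      ... | inj₁ ab                 = ab
      ... | inj₂ (inj₁ refl)        = contradiction sk ¬s₀
      ... | inj₂ (inj₂ (inj₁ refl)) = contradiction sk ¬s₁
      ... | inj₂ (inj₂ (inj₂ refl)) = contradiction sk ¬s₂

      ordered : SmallLabel (c (next i)) ⊎ TwoSmallLabels (c (next i)) →
                (SmallLabel a × SmallLabel b) × SmallsAB (c (next i))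
      ordered (inj₁ s₁) = contradiction s₁ ¬s₁
      ordered (inj₂ (k , k' , (sk , k⊆) , (sk' , k'⊆) , k≢k')) with only k sk k⊆ | only k' sk' k'⊆
      ... | inj₁ refl | inj₁ refl = contradiction refl k≢k'
      ... | inj₁ refl | inj₂ refl = (sk , sk') , (k⊆ , k'⊆) , only
      ... | inj₂ refl | inj₁ refl = (sk' , sk) , (k'⊆ , k⊆) , only
      ... | inj₂ refl | inj₂ refl = contradiction refl k≢k'

    nested-impossible : SmallLabel a → SmallLabel b → ∀ s i j → Far s i → Far s j →
      SmallsAB (c i) → SmallsAB (c j) → SmallLabel (c s) ⊎ SmallsAB (c s) →
      i ≢ j → ¬ (tube (c i) ⊆ tube (c j))
    nested-impossible (va , za , sta , ta≡) (vb , zb , stb , tb≡) s i j far-i far-j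
      ((a⊆i , b⊆i) , _) ((a⊆j , b⊆j) , only-j) s-type i≢j i⊆j
      with ⊈⇒∃∉ (λ j⊆i → i≢j (c-injective (injective (c i) (c j) (⊆-antisym i⊆j j⊆i))))
    ... | e , e∈j , e∉i = contra
      where
      ab⊆i : ∀ {k} → k ≡ a ⊎ k ≡ b → tube k ⊆ tube (c i)
      ab⊆i (inj₁ refl) = a⊆i
      ab⊆i (inj₂ refl) = b⊆i

      in-ab : ∀ {R} → Small R → R ⊆ tube (c j) → R ⊆ tube (c i) × (R ⊆ tube a ⊎ R ⊆ tube b)
      in-ab sR R⊆ with small-label {l = c j} sR R⊆
      ... | k , refl with only-j k sR R⊆
      ...   | inj₁ refl = a⊆i , inj₁ ⊆-refl
      ...   | inj₂ refl = b⊆i , inj₂ ⊆-refl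

      -- The small tube of `c j` through a minimal element must be `a` or `b`, and `c i` contains
      -- both.
      Min-in-j : ∀ {x} → Min x → x ∈ tube (c j) → x ∈ tube (c i) × (x ≡ va ⊎ x ≡ vb)
      Min-in-j mx x∈ with small-at (tube-Filled (c j)) x∈ mx
      ... | R , sR , R⊆ , x∈R with in-ab sR R⊆
      ...   | R⊆i , inj₁ R⊆a = R⊆i x∈R , inj₁ (stem-Min sta mx (subst (_ ∈_) ta≡ (R⊆a x∈R)))
      ...   | R⊆i , inj₂ R⊆b = R⊆i x∈R , inj₂ (stem-Min stb mx (subst (_ ∈_) tb≡ (R⊆b x∈R)))

      below-e : ∀ u → u < e → u ∈ tube (c i) × (u ≡ va ⊎ u ≡ vb)
      below-e u u<e = Min-in-j (below-Min u<e) (Filled-lower Q (tube-Filled (c j)) u<e e∈j)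

      only : ∀ u → u < e → u ≡ va ⊎ u ≡ vb
      only u u<e = proj₂ (below-e u u<e)

      above : ∃ λ u → u < e
      above with Min-or-above e
      ... | inj₁ me = contradiction (proj₁ (Min-in-j me e∈j)) e∉i
      ... | inj₂ p  = p

      -- With boundary {v}, `e` would be the tip of a small tube in `c j`, hence lie in `a` or `b`
      -- and so in `c i`. Thus the boundary of `e` is {va, vb}.
      not-loop : ∀ v → ¬ (∀ u → u < e → u ≡ v)
      not-loop v loop with above
      ... | u , u<e with loop u u<e
      ... | refl = e∉i (proj₁ (in-ab
        (u , e , (below-Min u<e , inj₂ (u<e , loop)) , refl)
        (stem-⊆ (Filled-lower Q (tube-Filled (c j)) u<e e∈j) e∈j)) (∈stem⁺ (inj₂ refl)))

      va<e : va < e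
      va<e = decidable-stable (<? va e) λ va≮e → not-loop vb λ u u<e →
        [ (λ { refl → contradiction u<e va≮e }) , id ]′ (only u u<e)

      vb<e : vb < e
      vb<e = decidable-stable (<? vb e) λ vb≮e → not-loop va λ u u<e →
        [ id , (λ { refl → contradiction u<e vb≮e }) ]′ (only u u<e)

      va≢vb : va ≢ vb
      va≢vb va≡vb = not-loop vb λ u u<e → [ (λ u≡va → trans u≡va va≡vb) , id ]′ (only u u<e)

      common : ∀ {J} (k : Label) → J ≡ tube k → adjacent k (c s) ≡ true → adjacent k (c j) ≡ true → J ⊆ tube (c i)
      common k refl ks kj = ab⊆i (far-j k ks kj)

      e∉s : e ∉ tube (c s)
      e∉s e∈s = excluded s-type
        where
        open Join sta stb va≢vb va<e vb<e only

        -- An element of a stem has at most one element below it, which rules out `c s` small.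
        -- Otherwise `join` is a tube inside both `c s` and `c j`, so it is `a` or `b` and puts `e`
        -- into `c i`.
        excluded : ¬ (SmallLabel (c s) ⊎ SmallsAB (c s))
        excluded (inj₁ (v , z , st , s≡)) =
          va≢vb (trans (at-v va va<e) (sym (at-v vb vb<e)))
          where at-v = proj₂ (stem-nonMin st va<e (subst (e ∈_) s≡ e∈s))
        excluded (inj₂ ((a⊆s , b⊆s) , _)) = joined (label join (join-IsTube , ⊆-≢⊤ J⊆s (proj₂ (tube-Proper (c s)))))
          where
          J⊆ : ∀ l → tube a ⊆ tube l → tube b ⊆ tube l → e ∈ tube l → join ⊆ tube l
          J⊆ l a⊆l b⊆l = join-⊆ (subst (_⊆ tube l) ta≡ a⊆l) (subst (_⊆ tube l) tb≡ b⊆l)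

          J⊆s : join ⊆ tube (c s)
          J⊆s = J⊆ (c s) a⊆s b⊆s e∈s

          joined : ¬ (∃ λ k → join ≡ tube k)
          joined (k , J≡) = e∉i (common k J≡
            (⊆⇒adjacent k (c s) (subst (_⊆ tube (c s)) J≡ J⊆s))
            (⊆⇒adjacent k (c j) (subst (_⊆ tube (c j)) J≡ (J⊆ (c j) a⊆j b⊆j e∈j)))
            e∈join)

      contra : ⊥
      -- `c i` contains the boundary of `e`, so some `f` in it meets the bundle, and a proper tube
      -- over `c s` and `c i` exists. By farness it is `a` or `b`; but it contains both, and these
      -- are not adjacent.
      contra with proj₂ (tube-Filled (c i)) e (λ u u<e → proj₁ (below-e u u<e))
      ... | f , f∈i , ef with avoiding-join (proj₁ (tube-Proper (c s))) (proj₁ (tube-Proper (c i)))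
                                (Far⇒¬Compatible far-i)
                                (λ e∈ → [ e∉s , e∉i ]′ (x∈p∪q⁻ (tube (c s)) (tube (c i)) e∈))
                                (x∈p∪q⁺ (inj₂ f∈i)) ef
      ... | J , tJ , s⊆J , i⊆J = labelled (label J tJ)
        where
        labelled : ¬ (∃ λ k → J ≡ tube k)
        labelled (k , refl) with far-i k (⊇⇒adjacent k (c s) s⊆J) (⊇⇒adjacent k (c i) i⊆J)
        ... | inj₁ refl = contradiction (⊆⇒adjacent b a (⊆-trans b⊆i i⊆J)) λ ()
        ... | inj₂ refl = contradiction (⊆⇒adjacent a b (⊆-trans a⊆i i⊆J)) λ ()

    -- The ends of the edge are compatible and both contain the nonempty `tube a`, so they are
    -- nested, in one order or the other.
    far-edge-impossible : ∀ s i → Far s i → Far s (next i) → SmallLabel a × SmallLabel b →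
      SmallsAB (c i) → SmallsAB (c (next i)) → SmallLabel (c s) ⊎ SmallsAB (c s) → ⊥
    far-edge-impossible s i far-i far-j (sa , sb) abi abj s-type
      with proj₁ (adjacent⇒ (c i) (c (next i)) (adjacent-next i))
    ... | inj₂ (inj₁ i⊆j) = nested-impossible sa sb s i (next i) far-i far-j abi abj s-type (next-≢ i) i⊆j
    ... | inj₂ (inj₂ j⊆i) = nested-impossible sa sb s (next i) i far-j far-i abj abi s-type (next-≢ i ∘ sym) j⊆i
    ... | inj₁ disjoint with Proper-Min (tube-Proper a)
    ...   | v , v∈a , _ = disjoint v (proj₁ (proj₁ abi) v∈a , proj₁ (proj₁ abj) v∈a)

    -- To apply `neighbours-smallsAB` to both ends of an edge, four consecutive cycle tubes must be
    -- non-small. If `s` is small, the tubes at distance 3, 4 and 5 after it are not, and the fourth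
    -- is sought next to these.
    no-labelling : ⊥
    no-labelling with any? (λ i → small? (c i))
    -- No small tube on the cycle: take position 1 for `s` and the edge from 4 to 5.
    ... | no none = far-edge-impossible i₁ (next i₃) (far-+3 i₁) (far-+4 i₁)
            (proj₁ (all zero)) (proj₂ (all i₃)) (proj₂ (all (next i₃))) (inj₂ (proj₂ (all zero)))
      where
      i₁ = next zero
      i₃ = next (next i₁)
      all : ∀ i → (SmallLabel a × SmallLabel b) × SmallsAB (c (next i))
      all i = neighbours-smallsAB i (λ p → none (_ , p)) (λ p → none (_ , p)) (λ p → none (_ , p))
    ... | yes (s , small-s) with small? (c (next (next s)))
    ...   | no ¬s₂ = far-edge-impossible s _ (far-+3 s) (far-+4 s) (proj₁ at₃) (proj₂ at₃) (proj₂ at₄) (inj₁ small-s)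
      where
      at₃ = neighbours-smallsAB _ ¬s₂ (far-smalls (far-+3 s) small-s) (far-smalls (far-+4 s) small-s)
      at₄ = neighbours-smallsAB _ (far-smalls (far-+3 s) small-s) (far-smalls (far-+4 s) small-s) (far-smalls (far-+5 s) small-s)
    -- Since `s` + 2 is small, the tube at `s` + 6, four steps further, is not; the edge moves one
    -- step on.
    ...   | yes s₂ = far-edge-impossible s _ (far-+4 s) (far-+5 s) (proj₁ at₄) (proj₂ at₄) (proj₂ at₅) (inj₁ small-s)
      where
      at₄ = neighbours-smallsAB _ (far-smalls (far-+3 s) small-s) (far-smalls (far-+4 s) small-s) (far-smalls (far-+5 s) small-s)
      at₅ = neighbours-smallsAB _ (far-smalls (far-+4 s) small-s) (far-smalls (far-+5 s) small-s)
              (far-smalls (far-+4 (next (next s))) s₂)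

theorem4p3 : Σ FinPoset λ P → ∀ (P' : FinPoset) → Height≤2 P' → ¬ CombEquivK P' P
theorem4p3 = prismPoset , λ P' h iso →
  HeightTwo.no-labelling P' h (transport P' prismPoset iso prismPoset-labelling)
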